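{- For every integer $n\ge 0$, the Tutte polynomial of the matroid $\mathcal M_n$ is $$T_{\mathcal M_n}(x,y)=\prod_{k=1}^n\bigl(x-1+(k)_y\bigr),$$ where $(k)_y=\frac{y^k-1}{y-1}$.
   Context: $[n]$ denotes the linearly ordered set $\{0<1<\dots<n\}$, with meet $i\wedge j=\min(i,j)$. $[n]^\to$ denotes the set of nontrivial edges of $[n]$, i.e. pairs $(i\to j)$ with $0\le i<j\le n$. A transfer system on $[n]$ is a partial order $T$ on the set $[n]$ that is contained in $\le$ (reflexive, transitive, and $i\,T\,j$ implies $i\le j$) and is closed under restriction: if $i\,T\,j$ and $k\in[n]$, then $(i\wedge k)\,T\,(j\wedge k)$. For every $S\subseteq[n]^\to$ there is a smallest transfer system containing $S$, called the transfer system generated by $S$. A set $S\subseteq [n]^\to$ is a minimal generating set if no proper subset of $S$ generates the same transfer system as $S$; $\mathrm{MGS}([n])\subseteq\mathcal P([n]^\to)$ denotes the collection of all minimal generating sets (of all transfer systems on $[n]$). $\mathcal M_n=([n]^\to,\mathrm{MGS}([n]))$ is the matroid with ground set $[n]^\to$ whose independent sets are the elements of $\mathrm{MGS}([n])$ (it is a fact that this pair is a matroid). For a matroid $(E,I)$ with ground set $E$ and collection of independent sets $I$, the rank $r(S)$ of $S\subseteq E$ is the size of a largest independent subset of $S$, and the Tutte polynomial is $$T_E(x,y)=\sum_{S\subseteq E}(x-1)^{r(E)-r(S)}(y-1)^{|S|-r(S)}.$$ The expression $(k)_y=\frac{y^k-1}{y-1}$ is the polynomial $1+y+\dots+y^{k-1}$.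 -}

module Defs where

open import Algebra.Bundles.Raw using (RawRing)
import Algebra.Construct.NaturalChoice.Min as Min
import Algebra.Definitions.RawSemiring as RawSemiringDefs
open import Data.Empty using (⊥-elim)
open import Data.Fin.Base using (Fin; zero; suc; toℕ; _≤_; _<_; splitAt; join)
open import Data.Fin.Properties
  using (_≟_; any?; all?; ≤-refl; ≤-trans; ≤-antisym; ≤-total; ≤-totalOrder;
         <-irrelevant; splitAt-join; join-splitAt; suc-injective)
open import Data.Fin.Subset
  using (Subset; inside; outside; _∈_; _∉_; _⊆_; _⊂_; ∣_∣; ⊥; ⊤; ⁅_⁆; _∪_)
  renaming (_-_ to infixl 5 _∖_)
open import Data.Fin.Subset.Properties
  using (_∈?_; _⊆?_; ∉⊥; x∈⁅y⁆⇒x≡y; x∈p∪q⁻; x∈p⇒p-x⊂p; x∈p⇒∣p-x∣<∣p∣;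
         x∈p∧x≢y⇒x∈p-y; drop-there)
import Data.Integer.Base as ℤ
open import Data.List.Base
  using (List; []; _∷_; _++_; map; foldr; filter; upTo; applyUpTo)
open import Data.List.Extrema.Nat using (max)
import Data.Nat.Base as ℕ
open import Data.Nat.Base using (ℕ; zero; suc; s≤s; z≤n; s≤s⁻¹; _∸_)
import Data.Nat.Properties as ℕ
open import Data.Product.Base using (Σ; Σ-syntax; ∃; _×_; _,_; proj₁; proj₂)
open import Data.Sum.Base using (_⊎_; inj₁; inj₂)
open import Data.Vec.Base using ([]; _∷_; here; there)
open import Function.Base using (_∘_)
open import Function.Bundles using (_↔_; mk↔ₛ′)
open import Level using (Level; 0ℓ)
open import Relation.Binary.Core using (Rel; _⇒_; _⇔_)
open import Relation.Binary.PropositionalEquality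
  using (_≡_; _≢_; refl; sym; trans; cong; subst; subst₂; isEquivalence)
open import Relation.Binary.Structures using (IsPartialOrder)
open import Relation.Nullary using (Dec; yes; no; ¬_)
open import Relation.Nullary.Decidable using (_×-dec_; _→-dec_; map′)
open import Relation.Unary using (Pred; Decidable)

-- The ground set is an arbitrary finite set; its subsets are coded as
-- subsets of Fin size through the bijection `enumeration`.

record Matroid : Set₁ where
  field
    Ground       : Set
    size         : ℕ
    enumeration  : Fin size ↔ Ground
    Independent  : Pred (Subset size) 0ℓ
    independent? : Decidable Independent
    empty        : Independent ⊥
    hereditary   : ∀ {I J} → I ⊆ J → Independent J → Independent I
    augmentation : ∀ {I J} → Independent I → Independent J → ∣ I ∣ ℕ.< ∣ J ∣ →
                   ∃ λ e → e ∈ J × e ∉ I × Independent (I ∪ ⁅ e ⁆)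

subsets : ∀ m → List (Subset m)
subsets zero    = [] ∷ []
subsets (suc m) = map (inside ∷_) (subsets m) ++ map (outside ∷_) (subsets m)

rank : (M : Matroid) → Subset (Matroid.size M) → ℕ
rank M S =
  max 0 (map ∣_∣ (filter (λ I → (I ⊆? S) ×-dec independent? I) (subsets size)))
  where open Matroid M

-- R [X] as lists of coefficients, constant term first, compared
-- coefficientwise (so trailing zeros are immaterial).

module _ {c ℓ : Level} (R : RawRing c ℓ) where
  open RawRing R

  coeff : List Carrier → ℕ → Carrier
  coeff []      _       = 0#
  coeff (a ∷ p) zero    = a
  coeff (a ∷ p) (suc i) = coeff p i

  addPoly : List Carrier → List Carrier → List Carrier
  addPoly []      q       = q
  addPoly (a ∷ p) []      = a ∷ p
  addPoly (a ∷ p) (b ∷ q) = (a + b) ∷ addPoly p q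

  mulPoly : List Carrier → List Carrier → List Carrier
  mulPoly []      q = []
  mulPoly (a ∷ p) q = addPoly (map (a *_) q) (0# ∷ mulPoly p q)

  infix 9 _[X]
  _[X] : RawRing c ℓ
  _[X] = record
    { Carrier = List Carrier
    ; _≈_     = λ p q → ∀ i → coeff p i ≈ coeff q i
    ; _+_     = addPoly
    ; _*_     = mulPoly
    ; -_      = map -_
    ; 0#      = []
    ; 1#      = 1# ∷ []
    }

ℤ[x] : RawRing 0ℓ 0ℓ
ℤ[x] = ℤ.+-*-rawRing [X]

ℤ[x,y] : RawRing 0ℓ 0ℓ
ℤ[x,y] = ℤ[x] [X]

open RawRing ℤ[x,y] public
  using (_≈_; _+_; _*_; -_; 0#; 1#) renaming (Carrier to Poly)

open RawSemiringDefs (RawRing.rawSemiring ℤ[x,y]) public using (_^_)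

x : Poly
x = (ℤ.0ℤ ∷ ℤ.1ℤ ∷ []) ∷ []

y : Poly
y = RawRing.0# ℤ[x] ∷ RawRing.1# ℤ[x] ∷ []

infixl 6 _⊖_
_⊖_ : Poly → Poly → Poly
p ⊖ q = p + (- q)

∑ : List Poly → Poly
∑ = foldr _+_ 0#

∏ : List Poly → Poly
∏ = foldr _*_ 1#

-- The polynomial (y ^ k - 1) / (y - 1).

⟨_⟩ʸ : ℕ → Poly
⟨ k ⟩ʸ = ∑ (map (y ^_) (upTo k))

-- No truncation takes place in the exponents, as rank S ≤ rank ⊤ and
-- rank S ≤ ∣ S ∣.

tutteTerm : (M : Matroid) → Subset (Matroid.size M) → Poly
tutteTerm M S = ((x ⊖ 1#) ^ (rank M ⊤ ∸ rank M S)) * ((y ⊖ 1#) ^ (∣ S ∣ ∸ rank M S))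

tutte : Matroid → Poly
tutte M = ∑ (map (tutteTerm M) (subsets (Matroid.size M)))

pigeonhole : ∀ {a b} (J : Subset a) (I : Subset b) (R : Fin a → Fin b → Set) →
             (∀ {e e′ f} → R e f → R e′ f → e ≡ e′) →
             (∀ e → e ∈ J → ∃ λ f → f ∈ I × R e f) → ∣ J ∣ ℕ.≤ ∣ I ∣
pigeonhole []            I R inj tot = z≤n
pigeonhole (outside ∷ J) I R inj tot =
  pigeonhole J I (R ∘ suc) (λ r r′ → suc-injective (inj r r′)) (λ e → tot (suc e) ∘ there {y = outside})
pigeonhole (inside ∷ J)  I R inj tot with tot zero here
... | f , f∈I , r =
  ℕ.≤-trans (s≤s (pigeonhole J (I ∖ f) (R ∘ suc) (λ r r′ → suc-injective (inj r r′)) tot′))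
            (x∈p⇒∣p-x∣<∣p∣ f∈I)
  where
  tot′ : ∀ e → e ∈ J → ∃ λ g → g ∈ (I ∖ f) × R (suc e) g
  tot′ e e∈J with tot (suc e) (there e∈J)
  ... | g , g∈I , r′ = g , x∈p∧x≢y⇒x∈p-y g∈I g≢f , r′
    where
    g≢f : g ≢ f
    g≢f refl with inj r r′
    ... | ()

-- The nontrivial edges of [n], whose underlying set {0, …, n} is Fin (suc n).

record Edge (n : ℕ) : Set where
  constructor edge
  field
    source : Fin (suc n)
    target : Fin (suc n)
    s<t    : source < target

open Edge public

#edges : ℕ → ℕ
#edges zero    = 0
#edges (suc n) = suc n ℕ.+ #edges n

-- First the edges with source 0, then the edges among 1, …, n.

lift-edge : ∀ {n} → Edge n → Edge (suc n)
lift-edge (edge i j i<j) = edge (suc i) (suc j) (s≤s i<j)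

split : ∀ {n} → Fin (suc n) ⊎ Fin (#edges n) → Edge (suc n)

nth : ∀ n → Fin (#edges n) → Edge n
nth (suc n) e = split (splitAt (suc n) e)

split (inj₁ j) = edge zero (suc j) (s≤s z≤n)
split (inj₂ e) = lift-edge (nth _ e)

index : ∀ n → Edge n → Fin (#edges n)
index zero    (edge zero zero ())
index (suc n) (edge zero    (suc j) _)   = join (suc n) (#edges n) (inj₁ j)
index (suc n) (edge (suc i) (suc j) i<j) =
  join (suc n) (#edges n) (inj₂ (index n (edge i j (s≤s⁻¹ i<j))))

nth-index : ∀ n (a : Edge n) → nth n (index n a) ≡ a
nth-index zero    (edge zero zero ())
nth-index (suc n) (edge zero (suc j) (s≤s z≤n)) =
  cong split (splitAt-join (suc n) (#edges n) (inj₁ j))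
nth-index (suc n) (edge (suc i) (suc j) (s≤s i<j)) =
  trans (cong split (splitAt-join (suc n) (#edges n) (inj₂ (index n (edge i j i<j)))))
        (cong lift-edge (nth-index n (edge i j i<j)))

index-nth : ∀ n (e : Fin (#edges n)) → index n (nth n e) ≡ e
index-nth (suc n) e =
  trans (index-split (splitAt (suc n) e)) (join-splitAt (suc n) (#edges n) e)
  where
  index-split : ∀ z → index (suc n) (split z) ≡ join (suc n) (#edges n) z
  index-split (inj₁ j) = refl
  index-split (inj₂ f) = cong (join (suc n) (#edges n) ∘ inj₂) (index-nth n f)

edges : ∀ n → Fin (#edges n) ↔ Edge n
edges n = mk↔ₛ′ (nth n) (index n) (nth-index n) (index-nth n)

module _ (n : ℕ) where

  private
    module ⊓ = Min (≤-totalOrder (suc n))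

  infixl 7 _∧_
  _∧_ : Fin (suc n) → Fin (suc n) → Fin (suc n)
  _∧_ = ⊓._⊓_

  record IsTransferSystem (T : Rel (Fin (suc n)) 0ℓ) : Set where
    field
      isPartialOrder : IsPartialOrder _≡_ T
      within-≤       : T ⇒ _≤_
      restriction    : ∀ {i j} → T i j → ∀ k → T (i ∧ k) (j ∧ k)

  EdgeIn : Subset (#edges n) → Rel (Fin (suc n)) 0ℓ
  EdgeIn S i j = Σ[ i<j ∈ i < j ] index n (edge i j i<j) ∈ S

  -- The transfer system generated by S (see `generated-isTransferSystem`
  -- and `generated-least`).

  data Generated (S : Subset (#edges n)) : Rel (Fin (suc n)) 0ℓ where
    incl     : ∀ {i j} → EdgeIn S i j → Generated S i j
    reflx    : ∀ {i} → Generated S i i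
    transit  : ∀ {i j k} → Generated S i j → Generated S j k → Generated S i k
    restrict : ∀ {i j} → Generated S i j → ∀ k →
               Generated S (i ∧ k) (j ∧ k)

  MinimalGenerating : Pred (Subset (#edges n)) 0ℓ
  MinimalGenerating S = ∀ {S′} → S′ ⊂ S → ¬ (Generated S′ ⇔ Generated S)

  generated-≤ : ∀ S → Generated S ⇒ _≤_
  generated-≤ S (incl (i<j , _))       = ℕ.<⇒≤ i<j
  generated-≤ S reflx                  = ≤-refl
  generated-≤ S (transit p q)          = ≤-trans (generated-≤ S p) (generated-≤ S q)
  generated-≤ S (restrict {i} {j} p k) = ⊓.⊓-monoˡ-≤ k (generated-≤ S p)

  generated-isTransferSystem : ∀ S → IsTransferSystem (Generated S)
  generated-isTransferSystem S = record
    { isPartialOrder = record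
      { isPreorder = record
        { isEquivalence = isEquivalence
        ; reflexive     = λ { refl → reflx }
        ; trans         = transit
        }
      ; antisym = λ p q → ≤-antisym (generated-≤ S p) (generated-≤ S q)
      }
    ; within-≤    = generated-≤ S
    ; restriction = restrict
    }

  generated-least : ∀ S {T} → IsTransferSystem T → EdgeIn S ⇒ T → Generated S ⇒ T
  generated-least S {T} isT S⊆T = go
    where
    open IsTransferSystem isT
    go : Generated S ⇒ T
    go (incl e)       = S⊆T e
    go reflx          = IsPartialOrder.refl isPartialOrder
    go (transit p q)  = IsPartialOrder.trans isPartialOrder (go p) (go q)
    go (restrict p k) = restriction (go p) k

-- The matroid axioms for minimal generating sets.  They are obtained
-- from the fact that S is a minimal generating set iff no two edges in
-- S share a source.

  src tgt : Fin (#edges n) → Fin (suc n)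
  src = source ∘ nth n
  tgt = target ∘ nth n

  DistinctSources : Pred (Subset (#edges n)) 0ℓ
  DistinctSources S = ∀ e f → e ∈ S → f ∈ S → src e ≡ src f → e ≡ f

  distinctSources? : Decidable DistinctSources
  distinctSources? S = all? λ e → all? λ f →
    (e ∈? S) →-dec ((f ∈? S) →-dec ((src e ≟ src f) →-dec (e ≟ f)))

  ∈⇒generated : ∀ {S} e → e ∈ S → Generated S (src e) (tgt e)
  ∈⇒generated {S} e e∈S =
    incl (s<t (nth n e) , subst (_∈ S) (sym (index-nth n e)) e∈S)

  index-irrelevant : ∀ {i j} (p q : i < j) → index n (edge i j p) ≡ index n (edge i j q)
  index-irrelevant p q = cong (index n ∘ edge _ _) (<-irrelevant p q)

  src-tgt-injective : ∀ e f → src e ≡ src f → tgt e ≡ tgt f → e ≡ f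
  src-tgt-injective e f s t =
    trans (sym (index-nth n e)) (trans (lemma (nth n e) (nth n f) s t) (index-nth n f))
    where
    lemma : ∀ (a b : Edge n) → source a ≡ source b → target a ≡ target b →
            index n a ≡ index n b
    lemma (edge _ _ p) (edge _ _ q) refl refl = index-irrelevant p q

  redundant : ∀ {S} e f → e ∈ S → f ∈ S → e ≢ f → src e ≡ src f → tgt e ≤ tgt f →
              ¬ MinimalGenerating S
  redundant {S} e f e∈S f∈S e≢f s≡ t≤ minimal = minimal S∖e⊂S (⇒₁ , ⇒₂)
    where
    S∖e⊂S : (S ∖ e) ⊂ S
    S∖e⊂S = x∈p⇒p-x⊂p e∈S

    ⇒₁ : Generated (S ∖ e) ⇒ Generated S
    ⇒₁ = generated-least (S ∖ e) (generated-isTransferSystem S)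
           (λ (p , i∈) → incl (p , proj₁ S∖e⊂S i∈))

    replacement : Generated (S ∖ e) (src e) (tgt e)
    replacement = subst₂ (Generated (S ∖ e))
      (trans (cong (λ s → s ∧ tgt e) (sym s≡))
             (⊓.x≤y⇒x⊓y≈x (ℕ.<⇒≤ (s<t (nth n e)))))
      (⊓.x≤y⇒y⊓x≈x t≤)
      (restrict (∈⇒generated f (x∈p∧x≢y⇒x∈p-y f∈S (e≢f ∘ sym))) (tgt e))

    keep : EdgeIn S ⇒ Generated (S ∖ e)
    keep {i} {j} (p , i∈) with index n (edge i j p) ≟ e
    ... | no  ≢e   = incl (p , x∈p∧x≢y⇒x∈p-y i∈ ≢e)
    ... | yes refl = subst₂ (Generated (S ∖ e))
      (cong source (nth-index n (edge i j p)))
      (cong target (nth-index n (edge i j p))) replacement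

    ⇒₂ : Generated S ⇒ Generated (S ∖ e)
    ⇒₂ = generated-least S (generated-isTransferSystem (S ∖ e)) keep

  minimal⇒distinct : ∀ {S} → MinimalGenerating S → DistinctSources S
  minimal⇒distinct minimal e f e∈S f∈S s≡ with e ≟ f
  ... | yes e≡f = e≡f
  ... | no  e≢f with ≤-total (tgt e) (tgt f)
  ...   | inj₁ t≤ = ⊥-elim (redundant e f e∈S f∈S e≢f s≡ t≤ minimal)
  ...   | inj₂ t≥ = ⊥-elim (redundant f e f∈S e∈S (e≢f ∘ sym) (sym s≡) t≥ minimal)

  leaves-source : ∀ {S i j} → Generated S i j → i ≢ j → ∃ λ e → e ∈ S × src e ≡ i
  leaves-source (incl {i} {j} (p , e∈)) _ =
    index n (edge i j p) , e∈ , cong source (nth-index n (edge i j p))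
  leaves-source reflx i≢i = ⊥-elim (i≢i refl)
  leaves-source (transit {i} {j} p q) i≢k with i ≟ j
  ... | yes refl = leaves-source q i≢k
  ... | no  i≢j  = leaves-source p i≢j
  leaves-source {S} (restrict {i} {j} p k) ≢
    with leaves-source p (≢ ∘ cong (λ i → i ∧ k))
  ... | e , e∈ , s≡ with ≤-total i k
  ...   | inj₁ i≤k = e , e∈ , s≡
  ...   | inj₂ k≤i = ⊥-elim (≢ (sym (⊓.x≤y⇒y⊓x≈x (≤-trans k≤i (generated-≤ S p)))))

  distinct⇒minimal : ∀ {S} → DistinctSources S → MinimalGenerating S
  distinct⇒minimal {S} distinct {S′} (S′⊆S , e , e∈S , e∉S′) (_ , S⇒S′)
    with leaves-source (S⇒S′ (∈⇒generated e e∈S)) (ℕ.<⇒≢ (s<t (nth n e)) ∘ cong toℕ)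
  ... | f , f∈S′ , s≡ =
    e∉S′ (subst (_∈ S′) (distinct f e (S′⊆S f∈S′) e∈S s≡) f∈S′)

  minimalGenerating? : Decidable MinimalGenerating
  minimalGenerating? S = map′ distinct⇒minimal minimal⇒distinct (distinctSources? S)

  distinct-augmentation : ∀ {I J} →
    DistinctSources I → DistinctSources J → ∣ I ∣ ℕ.< ∣ J ∣ →
    ∃ λ e → e ∈ J × e ∉ I × DistinctSources (I ∪ ⁅ e ⁆)
  distinct-augmentation {I} {J} dI dJ I<J with any? fresh?
    where
    Used : Fin (#edges n) → Set
    Used e = ∃ λ f → f ∈ I × src f ≡ src e
    used? : Decidable Used
    used? e = any? λ f → (f ∈? I) ×-dec (src f ≟ src e)
    fresh? : Decidable (λ e → e ∈ J × ¬ Used e)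
    fresh? e = (e ∈? J) ×-dec (used? e →-dec no λ ())
  ... | yes (e , e∈J , unused) = e , e∈J , (λ e∈I → unused (e , e∈I , refl)) , distinct
    where
    distinct : DistinctSources (I ∪ ⁅ e ⁆)
    distinct f g f∈ g∈ s≡ with x∈p∪q⁻ I ⁅ e ⁆ f∈ | x∈p∪q⁻ I ⁅ e ⁆ g∈
    ... | inj₁ f∈I | inj₁ g∈I = dI f g f∈I g∈I s≡
    ... | inj₁ f∈I | inj₂ g∈e with refl ← x∈⁅y⁆⇒x≡y e g∈e = ⊥-elim (unused (f , f∈I , s≡))
    ... | inj₂ f∈e | inj₁ g∈I with refl ← x∈⁅y⁆⇒x≡y e f∈e = ⊥-elim (unused (g , g∈I , sym s≡))
    ... | inj₂ f∈e | inj₂ g∈e = trans (x∈⁅y⁆⇒x≡y e f∈e) (sym (x∈⁅y⁆⇒x≡y e g∈e))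
  ... | no none = ⊥-elim (ℕ.<⇒≱ I<J (pigeonhole J I R R-inj R-tot))
    where
    R : Fin (#edges n) → Fin (#edges n) → Set
    R e f = e ∈ J × src f ≡ src e
    R-inj : ∀ {e e′ f} → R e f → R e′ f → e ≡ e′
    R-inj (e∈J , s) (e′∈J , s′) = dJ _ _ e∈J e′∈J (trans (sym s) s′)
    R-tot : ∀ e → e ∈ J → ∃ λ f → f ∈ I × R e f
    R-tot e e∈J with any? (λ f → (f ∈? I) ×-dec (src f ≟ src e))
    ... | yes (f , f∈I , s≡) = f , f∈I , e∈J , s≡
    ... | no  unused         = ⊥-elim (none (e , e∈J , unused))

𝓜 : ℕ → Matroid
𝓜 n = record
  { Ground       = Edge n
  ; size         = #edges n
  ; enumeration  = edges n
  ; Independent  = MinimalGenerating n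
  ; independent? = minimalGenerating? n
  ; empty        = distinct⇒minimal n λ _ _ e∈⊥ → ⊥-elim (∉⊥ e∈⊥)
  ; hereditary   = λ I⊆J minJ → distinct⇒minimal n λ e f e∈I f∈I →
                     minimal⇒distinct n minJ e f (I⊆J e∈I) (I⊆J f∈I)
  ; augmentation = λ minI minJ I<J →
      let e , e∈J , e∉I , distinct =
            distinct-augmentation n (minimal⇒distinct n minI) (minimal⇒distinct n minJ) I<J
      in  e , e∈J , e∉I , distinct⇒minimal n distinct
  }

{-# OPTIONS --safe #-}

-- The edges of [n + 1] are the n + 1 edges with source 0 together with a copy
-- of the edges of [n].  As a set is independent iff no two of its edges share
-- a source, 𝓜 (n + 1) is the direct sum of a rank one uniform matroid on
-- n + 1 elements and 𝓜 n, so the Tutte polynomial is multiplicative.  The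
-- Tutte polynomial t k of the rank one uniform matroid on k elements satisfies
-- t 0 = x - 1 (its formula is read with r(E) = 1 also for k = 0) and, on
-- splitting the subsets according to whether they contain a fixed element,
-- t (k + 1) = Σ_A (y - 1)^|A| + t k = y^k + t k.

module Submission where

open import Defs hiding (_≈_; _+_; _*_; -_; 0#; 1#; _^_)
open import Algebra.Bundles using (CommutativeRing)
open import Algebra.Bundles.Raw using (RawRing)
import Algebra.Properties.CommutativeSemigroup as CommutativeSemigroup
import Algebra.Properties.Semiring.Exp as Exp
open import Data.Fin.Base using (Fin; zero; suc; _↑ˡ_; _↑ʳ_; splitAt)
open import Data.Fin.Properties
  using (splitAt-↑ˡ; splitAt-↑ʳ; splitAt⁻¹-↑ˡ; splitAt⁻¹-↑ʳ; ↑ˡ-injective; ↑ʳ-injective; suc-injective)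
open import Data.Fin.Subset
  using (Subset; inside; outside; _∈_; _⊆_; ∣_∣; ⊤; ⊥; ⁅_⁆)
open import Data.Fin.Subset.Properties
  using (_⊆?_; ⊆⊤; ⊥⊆; ∉⊥; ∣⊥∣≡0; ∣⁅x⁆∣≡1; p⊆q⇒∣p∣≤∣q∣; nonempty?; Empty-unique;
         x∈⁅y⁆⇒x≡y)
import Data.Integer.Properties as ℤ
open import Data.List.Base using (List; []; _∷_; _++_; map; foldr; filter; upTo; applyUpTo)
open import Data.List.Extrema.Nat using (argmax-sel; v≤max⁺)
open import Data.List.Membership.Propositional using () renaming (_∈_ to _∈ᴸ_)
open import Data.List.Membership.Propositional.Properties
  using (∈-map⁺; ∈-map⁻; ∈-++⁺ˡ; ∈-++⁺ʳ; ∈-filter⁺; ∈-filter⁻)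
open import Data.List.Properties using (map-++; map-∘; applyUpTo-∷ʳ)
import Data.List.Relation.Unary.Any as Any
open import Data.List.Relation.Unary.Any using (here; there)
import Data.Nat.Base as ℕ
open import Data.Nat.Base using (ℕ; zero; suc; _∸_; _⊓_)
import Data.Nat.Properties as ℕ
open import Data.Product.Base using (∃; _×_; _,_)
open import Data.Sum.Base using (inj₁; inj₂)
import Data.Vec.Base as Vec
open import Data.Vec.Base using ([]; _∷_)
open import Function.Base using (_∘_; id)
open import Relation.Binary.PropositionalEquality as ≡ using (_≡_; refl)
open import Relation.Nullary using (yes; no; contradiction)
open import Relation.Nullary.Decidable using (_×-dec_)

-- Polynomial rings

module Convolution {c ℓ} (R : CommutativeRing c ℓ) where
  open CommutativeRing R renaming (Carrier to A)
  open CommutativeSemigroup +-commutativeSemigroup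
    using () renaming (interchange to +-interchange)
  open import Relation.Binary.Reasoning.Setoid setoid

  infixl 7 _✶_
  -- The Cauchy product of coefficient sequences, shifting the left factor as `mulPoly` does. Lists
  -- give coefficients only up to trailing zeros, so the multiplicative laws are proved for
  -- sequences and transferred along `coeff-*`.
  _✶_ : (ℕ → A) → (ℕ → A) → ℕ → A
  (f ✶ g) zero    = f 0 * g 0
  (f ✶ g) (suc n) = f 0 * g (suc n) + ((f ∘ suc) ✶ g) n

  ✶-cong : ∀ {f f′ g g′} → (∀ i → f i ≈ f′ i) → (∀ i → g i ≈ g′ i) →
           ∀ n → (f ✶ g) n ≈ (f′ ✶ g′) n
  ✶-cong f≈ g≈ zero    = *-cong (f≈ 0) (g≈ 0)
  ✶-cong f≈ g≈ (suc n) = +-cong (*-cong (f≈ 0) (g≈ (suc n))) (✶-cong (f≈ ∘ suc) g≈ n)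

  ✶-zeroˡ : ∀ g n → ((λ _ → 0#) ✶ g) n ≈ 0#
  ✶-zeroˡ g zero    = zeroˡ _
  ✶-zeroˡ g (suc n) = trans (+-cong (zeroˡ _) (✶-zeroˡ g n)) (+-identityˡ _)

  ✶-distribʳ : ∀ h f g n → ((λ i → f i + g i) ✶ h) n ≈ (f ✶ h) n + (g ✶ h) n
  ✶-distribʳ h f g zero    = distribʳ _ _ _
  ✶-distribʳ h f g (suc n) = begin
    (f 0 + g 0) * h (suc n) + ((λ i → f (suc i) + g (suc i)) ✶ h) n
      ≈⟨ +-cong (distribʳ _ _ _) (✶-distribʳ h (f ∘ suc) (g ∘ suc) n) ⟩
    (f 0 * h (suc n) + g 0 * h (suc n)) + (((f ∘ suc) ✶ h) n + ((g ∘ suc) ✶ h) n)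
      ≈⟨ +-interchange _ _ _ _ ⟩
    (f ✶ h) (suc n) + (g ✶ h) (suc n) ∎

  ✶-scaleˡ : ∀ a f g n → ((λ i → a * f i) ✶ g) n ≈ a * (f ✶ g) n
  ✶-scaleˡ a f g zero    = *-assoc _ _ _
  ✶-scaleˡ a f g (suc n) =
    trans (+-cong (*-assoc _ _ _) (✶-scaleˡ a (f ∘ suc) g n)) (sym (distribˡ _ _ _))

  -- Shifting `f ✶ g` leaves a multiple of the shifted `g` plus the shifted `f` convolved with `g`.
  -- The induction hypothesis covers the latter; the former completes `f 0 * (g ✶ h) (suc n)`.
  ✶-assoc : ∀ f g h n → ((f ✶ g) ✶ h) n ≈ (f ✶ (g ✶ h)) n
  ✶-assoc f g h zero    = *-assoc _ _ _
  ✶-assoc f g h (suc n) = begin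
    f 0 * g 0 * h (suc n) + ((λ i → f 0 * g (suc i) + ((f ∘ suc) ✶ g) i) ✶ h) n
      ≈⟨ +-cong (*-assoc _ _ _) (✶-distribʳ h _ _ n) ⟩
    f 0 * (g 0 * h (suc n)) +
      (((λ i → f 0 * g (suc i)) ✶ h) n + (((f ∘ suc) ✶ g) ✶ h) n)
      ≈⟨ +-congˡ (+-cong (✶-scaleˡ _ _ h n) (✶-assoc (f ∘ suc) g h n)) ⟩
    f 0 * (g 0 * h (suc n)) + (f 0 * ((g ∘ suc) ✶ h) n + ((f ∘ suc) ✶ (g ✶ h)) n)
      ≈⟨ +-assoc _ _ _ ⟨
    f 0 * (g 0 * h (suc n)) + f 0 * ((g ∘ suc) ✶ h) n + ((f ∘ suc) ✶ (g ✶ h)) n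
      ≈⟨ +-congʳ (distribˡ _ _ _) ⟨
    (f ✶ (g ✶ h)) (suc n) ∎

  -- The recursion splits off the summand with `f 0`; commutativity also needs the one at the other
  -- end, with `g 0`.
  ✶-last : ∀ f g n → (f ✶ g) (suc n) ≈ (f ✶ (g ∘ suc)) n + f (suc n) * g 0
  ✶-last f g zero    = CommutativeRing.refl R
  ✶-last f g (suc n) = trans (+-congˡ (✶-last (f ∘ suc) g n)) (sym (+-assoc _ _ _))

  ✶-comm : ∀ f g n → (f ✶ g) n ≈ (g ✶ f) n
  ✶-comm f g zero    = *-comm _ _
  ✶-comm f g (suc n) = begin
    f 0 * g (suc n) + ((f ∘ suc) ✶ g) n ≈⟨ +-cong (*-comm _ _) (✶-comm (f ∘ suc) g n) ⟩
    g (suc n) * f 0 + (g ✶ (f ∘ suc)) n ≈⟨ +-comm _ _ ⟩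
    (g ✶ (f ∘ suc)) n + g (suc n) * f 0 ≈⟨ ✶-last g f n ⟨
    (g ✶ f) (suc n)                     ∎

module Polynomials {c ℓ} (R : CommutativeRing c ℓ) where
  open CommutativeRing R renaming (Carrier to A; refl to ≈-refl)
  open Convolution R
  open import Relation.Binary.Reasoning.Setoid setoid

  private
    module P = RawRing (rawRing [X])

    infixl 8 _!_
    _!_ : List A → ℕ → A
    _!_ = coeff rawRing

  coeff-+ : ∀ p q i → (p P.+ q) ! i ≈ p ! i + q ! i
  coeff-+ []      q       i       = sym (+-identityˡ _)
  coeff-+ (a ∷ p) []      i       = sym (+-identityʳ _)
  coeff-+ (a ∷ p) (b ∷ q) zero    = ≈-refl
  coeff-+ (a ∷ p) (b ∷ q) (suc i) = coeff-+ p q i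

  coeff-scale : ∀ a p i → map (a *_) p ! i ≈ a * p ! i
  coeff-scale a []      i       = sym (zeroʳ a)
  coeff-scale a (b ∷ p) zero    = ≈-refl
  coeff-scale a (b ∷ p) (suc i) = coeff-scale a p i

  coeff-neg : ∀ p i → (P.- p) ! i ≈ - (p ! i)
  -- Negation fixes zero: `- 0# ≈ 0# + - 0# ≈ 0#`.
  coeff-neg []      i       = sym (trans (sym (+-identityˡ _)) (-‿inverseʳ 0#))
  coeff-neg (a ∷ p) zero    = ≈-refl
  coeff-neg (a ∷ p) (suc i) = coeff-neg p i

  coeff-* : ∀ p q i → (p P.* q) ! i ≈ (p !_ ✶ q !_) i
  coeff-* []      q i       = sym (✶-zeroˡ _ i)
  -- The shifted part `0# ∷ mulPoly p q` adds nothing to the constant term.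
  coeff-* (a ∷ p) q zero    = trans (coeff-+ (map (a *_) q) _ 0)
    (trans (+-identityʳ _) (coeff-scale a q 0))
  coeff-* (a ∷ p) q (suc i) = trans (coeff-+ (map (a *_) q) _ (suc i))
    (+-cong (coeff-scale a q (suc i)) (coeff-* p q i))

  ✶-identityˡ-coeff : ∀ p i → (P.1# !_ ✶ p !_) i ≈ p ! i
  ✶-identityˡ-coeff p zero    = *-identityˡ _
  ✶-identityˡ-coeff p (suc i) =
    trans (+-cong (*-identityˡ _) (✶-zeroˡ _ i)) (+-identityʳ _)

  *-comm-[X] : ∀ p q → (p P.* q) P.≈ (q P.* p)
  *-comm-[X] p q i = trans (coeff-* p q i) (trans (✶-comm _ _ i) (sym (coeff-* q p i)))

  *-identityˡ-[X] : ∀ p → (P.1# P.* p) P.≈ p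
  *-identityˡ-[X] p i = trans (coeff-* P.1# p i) (✶-identityˡ-coeff p i)

  *-distribʳ-[X] : ∀ r p q → ((p P.+ q) P.* r) P.≈ ((p P.* r) P.+ (q P.* r))
  *-distribʳ-[X] r p q i = begin
    ((p P.+ q) P.* r) ! i                  ≈⟨ coeff-* (p P.+ q) r i ⟩
    ((p P.+ q) !_ ✶ r !_) i                ≈⟨ ✶-cong (coeff-+ p q) (λ _ → ≈-refl) i ⟩
    ((λ j → p ! j + q ! j) ✶ r !_) i       ≈⟨ ✶-distribʳ _ _ _ i ⟩
    (p !_ ✶ r !_) i + (q !_ ✶ r !_) i      ≈⟨ +-cong (coeff-* p r i) (coeff-* q r i) ⟨
    (p P.* r) ! i + (q P.* r) ! i          ≈⟨ coeff-+ (p P.* r) (q P.* r) i ⟨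
    ((p P.* r) P.+ (q P.* r)) ! i          ∎

  *-assoc-[X] : ∀ p q r → ((p P.* q) P.* r) P.≈ (p P.* (q P.* r))
  *-assoc-[X] p q r i = begin
    ((p P.* q) P.* r) ! i          ≈⟨ coeff-* (p P.* q) r i ⟩
    ((p P.* q) !_ ✶ r !_) i        ≈⟨ ✶-cong (coeff-* p q) (λ _ → ≈-refl) i ⟩
    ((p !_ ✶ q !_) ✶ r !_) i       ≈⟨ ✶-assoc _ _ _ i ⟩
    (p !_ ✶ (q !_ ✶ r !_)) i       ≈⟨ ✶-cong (λ _ → ≈-refl) (coeff-* q r) i ⟨
    (p !_ ✶ (q P.* r) !_) i        ≈⟨ coeff-* p (q P.* r) i ⟨
    (p P.* (q P.* r)) ! i          ∎

  -- Applied twice below, first to the integers and then to the result. The operations are those of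
  -- `rawRing [X]`, so no transport to `ℤ[x,y]` is needed.
  commutativeRing-[X] : CommutativeRing c ℓ
  commutativeRing-[X] = record
    { Carrier = P.Carrier
    ; _≈_     = P._≈_
    ; _+_     = P._+_
    ; _*_     = P._*_
    ; -_      = P.-_
    ; 0#      = P.0#
    ; 1#      = P.1#
    ; isCommutativeRing = record
      { isRing = record
        { +-isAbelianGroup = record
          { isGroup = record
            { isMonoid = record
              { isSemigroup = record
                { isMagma = record
                  { isEquivalence = record
                    { refl  = λ _ → ≈-refl
                    ; sym   = λ p≈q i → sym (p≈q i)
                    ; trans = λ p≈q q≈r i → trans (p≈q i) (q≈r i)
                    }
                  ; ∙-cong = λ {p} {p′} {q} {q′} p≈ q≈ i →
                      trans (coeff-+ p q i) (trans (+-cong (p≈ i) (q≈ i)) (sym (coeff-+ p′ q′ i)))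
                  }
                ; assoc = λ p q r i →
                    trans (coeff-+ (p P.+ q) r i) (trans (+-congʳ (coeff-+ p q i))
                      (trans (+-assoc _ _ _) (sym (trans (coeff-+ p (q P.+ r) i) (+-congˡ (coeff-+ q r i))))))
                }
              ; identity = (λ p i → trans (coeff-+ P.0# p i) (+-identityˡ _))
                         , (λ p i → trans (coeff-+ p P.0# i) (+-identityʳ _))
              }
            ; inverse = (λ p i → trans (coeff-+ (P.- p) p i)
                          (trans (+-congʳ (coeff-neg p i)) (-‿inverseˡ _)))
                      , (λ p i → trans (coeff-+ p (P.- p) i)
                          (trans (+-congˡ (coeff-neg p i)) (-‿inverseʳ _)))
            ; ⁻¹-cong = λ {p} {q} p≈q i →
                trans (coeff-neg p i) (trans (-‿cong (p≈q i)) (sym (coeff-neg q i)))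
            }
          ; comm = λ p q i →
              trans (coeff-+ p q i) (trans (+-comm _ _) (sym (coeff-+ q p i)))
          }
        ; *-cong = λ {p} {p′} {q} {q′} p≈ q≈ i →
            trans (coeff-* p q i) (trans (✶-cong p≈ q≈ i) (sym (coeff-* p′ q′ i)))
        ; *-assoc = *-assoc-[X]
        ; *-identity = *-identityˡ-[X]
                     , (λ p i → trans (*-comm-[X] p P.1# i) (*-identityˡ-[X] p i))
        ; distrib = (λ r p q i → begin
              (r P.* (p P.+ q)) ! i              ≈⟨ *-comm-[X] r (p P.+ q) i ⟩
              ((p P.+ q) P.* r) ! i              ≈⟨ *-distribʳ-[X] r p q i ⟩
              ((p P.* r) P.+ (q P.* r)) ! i      ≈⟨ coeff-+ (p P.* r) (q P.* r) i ⟩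
              (p P.* r) ! i + (q P.* r) ! i      ≈⟨ +-cong (*-comm-[X] p r i) (*-comm-[X] q r i) ⟩
              (r P.* p) ! i + (r P.* q) ! i      ≈⟨ coeff-+ (r P.* p) (r P.* q) i ⟨
              ((r P.* p) P.+ (r P.* q)) ! i      ∎)
          , *-distribʳ-[X]
        }
      ; *-comm = *-comm-[X]
      }
    }

-- Sums over subsets

module SubsetSums {c ℓ} (R : CommutativeRing c ℓ) where
  open CommutativeRing R renaming (Carrier to A; refl to ≈-refl; setoid to ≈-setoid)
  open Exp semiring using (_^_)
  open import Relation.Binary.Reasoning.Setoid ≈-setoid

  sum product : List A → A
  sum     = foldr _+_ 0#
  product = foldr _*_ 1#

  sum-++ : ∀ as bs → sum (as ++ bs) ≈ sum as + sum bs
  sum-++ []       bs = sym (+-identityˡ _)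
  sum-++ (a ∷ as) bs = trans (+-congˡ (sum-++ as bs)) (sym (+-assoc _ _ _))

  product-++ : ∀ as bs → product (as ++ bs) ≈ product as * product bs
  product-++ []       bs = sym (*-identityˡ _)
  product-++ (a ∷ as) bs = trans (*-congˡ (product-++ as bs)) (sym (*-assoc _ _ _))

  sum-map-upTo-suc : ∀ (f : ℕ → A) n → sum (map f (upTo (suc n))) ≈ sum (map f (upTo n)) + f n
  sum-map-upTo-suc f n = begin
    sum (map f (upTo (suc n)))          ≡⟨ ≡.cong (sum ∘ map f) (applyUpTo-∷ʳ id n) ⟨
    sum (map f (upTo n ++ n ∷ []))      ≡⟨ ≡.cong sum (map-++ f (upTo n) _) ⟩
    sum (map f (upTo n) ++ f n ∷ [])    ≈⟨ sum-++ (map f (upTo n)) _ ⟩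
    sum (map f (upTo n)) + (f n + 0#)   ≈⟨ +-congˡ (+-identityʳ _) ⟩
    sum (map f (upTo n)) + f n          ∎

  product-map-applyUpTo-suc : ∀ (f : ℕ → A) g n →
    product (map f (applyUpTo g (suc n))) ≈ product (map f (applyUpTo g n)) * f (g n)
  product-map-applyUpTo-suc f g n = begin
    product (map f (applyUpTo g (suc n)))
      ≡⟨ ≡.cong (product ∘ map f) (applyUpTo-∷ʳ g n) ⟨
    product (map f (applyUpTo g n ++ g n ∷ []))
      ≡⟨ ≡.cong product (map-++ f (applyUpTo g n) _) ⟩
    product (map f (applyUpTo g n) ++ f (g n) ∷ [])
      ≈⟨ product-++ (map f (applyUpTo g n)) _ ⟩
    product (map f (applyUpTo g n)) * (f (g n) * 1#)
      ≈⟨ *-congˡ (*-identityʳ _) ⟩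
    product (map f (applyUpTo g n)) * f (g n) ∎

  Σ⊆ : ∀ m → (Subset m → A) → A
  Σ⊆ m f = sum (map f (subsets m))

  Σ⊆-suc : ∀ m f → Σ⊆ (suc m) f ≈ Σ⊆ m (f ∘ (inside ∷_)) + Σ⊆ m (f ∘ (outside ∷_))
  Σ⊆-suc m f = begin
    sum (map f (map (inside ∷_) (subsets m) ++ map (outside ∷_) (subsets m)))
      ≡⟨ ≡.cong sum (map-++ f (map (inside ∷_) (subsets m)) _) ⟩
    sum (map f (map (inside ∷_) (subsets m)) ++ map f (map (outside ∷_) (subsets m)))
      ≈⟨ sum-++ (map f (map (inside ∷_) (subsets m))) _ ⟩
    sum (map f (map (inside ∷_) (subsets m))) + sum (map f (map (outside ∷_) (subsets m)))
      ≡⟨ ≡.cong₂ (λ as bs → sum as + sum bs) (map-∘ (subsets m)) (map-∘ (subsets m)) ⟨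
    Σ⊆ m (f ∘ (inside ∷_)) + Σ⊆ m (f ∘ (outside ∷_)) ∎

  Σ⊆-scale : ∀ m {f g} a → (∀ S → f S ≈ a * g S) → Σ⊆ m f ≈ a * Σ⊆ m g
  Σ⊆-scale m {f} {g} a f≈ = go (subsets m)
    where
    go : ∀ Ss → sum (map f Ss) ≈ a * sum (map g Ss)
    go []       = sym (zeroʳ a)
    go (S ∷ Ss) = trans (+-cong (f≈ S) (go Ss)) (sym (distribˡ a _ _))

  -- Subsets of a disjoint union are pairs of subsets, so a summand that factors yields a product of
  -- sums. `f` varies in the induction, absorbing the choice made for the first element.
  Σ⊆-++ : ∀ m k {h} f {g} → (∀ (S : Subset m) (T : Subset k) → h (S Vec.++ T) ≈ f S * g T) →
          Σ⊆ (m ℕ.+ k) h ≈ Σ⊆ m f * Σ⊆ k g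
  Σ⊆-++ zero    k {h} f {g} h≈ =
    -- The empty set has one subset, so the left sum is `f [] + 0#`.
    trans (Σ⊆-scale k (f []) (h≈ [])) (*-congʳ (sym (+-identityʳ _)))
  Σ⊆-++ (suc m) k {h} f {g} h≈ = begin
    Σ⊆ (suc m ℕ.+ k) h
      ≈⟨ Σ⊆-suc (m ℕ.+ k) h ⟩
    Σ⊆ (m ℕ.+ k) (h ∘ (inside ∷_)) + Σ⊆ (m ℕ.+ k) (h ∘ (outside ∷_))
      ≈⟨ +-cong (Σ⊆-++ m k (f ∘ (inside ∷_)) (h≈ ∘ (inside ∷_)))
                (Σ⊆-++ m k (f ∘ (outside ∷_)) (h≈ ∘ (outside ∷_))) ⟩
    Σ⊆ m (f ∘ (inside ∷_)) * Σ⊆ k g + Σ⊆ m (f ∘ (outside ∷_)) * Σ⊆ k g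
      ≈⟨ distribʳ _ _ _ ⟨
    (Σ⊆ m (f ∘ (inside ∷_)) + Σ⊆ m (f ∘ (outside ∷_))) * Σ⊆ k g
      ≈⟨ *-congʳ (Σ⊆-suc m f) ⟨
    Σ⊆ (suc m) f * Σ⊆ k g ∎

  -- The summand of a rank one uniform matroid, where S has rank 1 ⊓ ∣ S ∣.
  uniformTerm : A → A → ∀ {m} → Subset m → A
  uniformTerm u v S = u ^ (1 ∸ 1 ⊓ ∣ S ∣) * v ^ (∣ S ∣ ∸ 1 ⊓ ∣ S ∣)

  module _ (v w : A) (v+1≈w : v + 1# ≈ w) where

    -- The binomial theorem for `(v + 1#) ^ m`: each element contributes `v` if chosen and 1
    -- otherwise. A separate `w` lets `v = y - 1` give powers of `y` itself.
    Σ⊆-binomial : ∀ m → Σ⊆ m (λ S → v ^ ∣ S ∣) ≈ w ^ m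
    Σ⊆-binomial zero    = +-identityʳ 1#
    Σ⊆-binomial (suc m) = begin
      Σ⊆ (suc m) (λ S → v ^ ∣ S ∣)
        ≈⟨ Σ⊆-suc m _ ⟩
      Σ⊆ m (λ S → v * v ^ ∣ S ∣) + Σ⊆ m (λ S → v ^ ∣ S ∣)
        ≈⟨ +-cong (Σ⊆-scale m v (λ _ → ≈-refl)) (sym (*-identityˡ _)) ⟩
      v * Σ⊆ m (λ S → v ^ ∣ S ∣) + 1# * Σ⊆ m (λ S → v ^ ∣ S ∣)
        ≈⟨ distribʳ _ _ _ ⟨
      (v + 1#) * Σ⊆ m (λ S → v ^ ∣ S ∣)
        ≈⟨ *-cong v+1≈w (Σ⊆-binomial m) ⟩
      w * w ^ m ∎

    Σ⊆-uniformTerm : ∀ u m → Σ⊆ m (uniformTerm u v) ≈ u + sum (map (w ^_) (upTo m))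
    Σ⊆-uniformTerm u zero    = begin
      u * 1# * 1# + 0# ≈⟨ +-congʳ (trans (*-identityʳ _) (*-identityʳ _)) ⟩
      u + 0#           ∎
    Σ⊆-uniformTerm u (suc m) = begin
      Σ⊆ (suc m) (uniformTerm u v)
        ≈⟨ Σ⊆-suc m (uniformTerm u v) ⟩
      -- Once the first element is chosen, `1 ⊓ ∣ S ∣` computes to 1: the exponent of `u` is 0 and
      -- that of `v` counts the remaining elements.
      Σ⊆ m (λ S → 1# * v ^ ∣ S ∣) + Σ⊆ m (uniformTerm u v)
        ≈⟨ +-cong (trans (Σ⊆-scale m 1# (λ _ → ≈-refl)) (*-identityˡ _)) (Σ⊆-uniformTerm u m) ⟩
      Σ⊆ m (λ S → v ^ ∣ S ∣) + (u + sum (map (w ^_) (upTo m)))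
        ≈⟨ +-congʳ (Σ⊆-binomial m) ⟩
      w ^ m + (u + sum (map (w ^_) (upTo m)))
        ≈⟨ trans (+-comm _ _) (+-assoc _ _ _) ⟩
      u + (sum (map (w ^_) (upTo m)) + w ^ m)
        ≈⟨ +-congˡ (sum-map-upTo-suc (w ^_) m) ⟨
      u + sum (map (w ^_) (upTo (suc m))) ∎

-- Ranks

∈-subsets : ∀ {m} (S : Subset m) → S ∈ᴸ subsets m
∈-subsets []            = here refl
∈-subsets (inside ∷ S)  = ∈-++⁺ˡ (∈-map⁺ _ (∈-subsets S))
∈-subsets (outside ∷ S) = ∈-++⁺ʳ _ (∈-map⁺ _ (∈-subsets S))

module _ (M : Matroid) where
  open Matroid M

  -- The maximum is either an entry of the list or the default 0, and the empty set attains the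
  -- default.
  rank-attained : ∀ S → ∃ λ I → I ⊆ S × Independent I × ∣ I ∣ ≡ rank M S
  rank-attained S with argmax-sel id 0 (map ∣_∣ (filter (λ I → (I ⊆? S) ×-dec independent? I) (subsets size)))
  ... | inj₁ rank≡0 = ⊥ , ⊥⊆ , empty , ≡.trans (∣⊥∣≡0 size) (≡.sym rank≡0)
  ... | inj₂ rank∈ with ∈-map⁻ ∣_∣ rank∈
  ...   | I , I∈ , rank≡ with ∈-filter⁻ (λ I → (I ⊆? S) ×-dec independent? I) {xs = subsets size} I∈
  ...     | _ , I⊆S , ind = I , I⊆S , ind , ≡.sym rank≡

  independent-≤-rank : ∀ {I S} → I ⊆ S → Independent I → ∣ I ∣ ℕ.≤ rank M S
  independent-≤-rank {I} {S} I⊆S ind = v≤max⁺ 0 _ (inj₂ (Any.map ℕ.≤-reflexive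
    (∈-map⁺ ∣_∣ (∈-filter⁺ (λ I → (I ⊆? S) ×-dec independent? I) (∈-subsets I) (I⊆S , ind)))))

  -- The witness bounds the rank from below, and a largest independent subset obeys `bound`. Ranks
  -- are computed this way, without unfolding the maximum.
  rank-unique : ∀ {S I r} → I ⊆ S → Independent I → ∣ I ∣ ≡ r →
                (∀ {J} → J ⊆ S → Independent J → ∣ J ∣ ℕ.≤ r) → rank M S ≡ r
  rank-unique {S} I⊆S ind refl bound with rank-attained S
  ... | J , J⊆S , indJ , J≡ = ℕ.≤-antisym
    (ℕ.≤-trans (ℕ.≤-reflexive (≡.sym J≡)) (bound J⊆S indJ))
    (independent-≤-rank I⊆S ind)

  rank-mono : ∀ {S T} → S ⊆ T → rank M S ℕ.≤ rank M T
  rank-mono {S} S⊆T with rank-attained S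
  ... | I , I⊆S , ind , I≡ = ≡.subst (ℕ._≤ _) I≡ (independent-≤-rank (S⊆T ∘ I⊆S) ind)

  rank-≤-size : ∀ S → rank M S ℕ.≤ ∣ S ∣
  rank-≤-size S with rank-attained S
  ... | I , I⊆S , _ , I≡ = ≡.subst (ℕ._≤ _) I≡ (p⊆q⇒∣p∣≤∣q∣ I⊆S)

-- Subsets of a disjoint union, coded as concatenations

∣++∣ : ∀ {m k} (S : Subset m) (T : Subset k) → ∣ S Vec.++ T ∣ ≡ ∣ S ∣ ℕ.+ ∣ T ∣
∣++∣ []            T = refl
∣++∣ (inside ∷ S)  T = ≡.cong suc (∣++∣ S T)
∣++∣ (outside ∷ S) T = ∣++∣ S T

⊤-++ : ∀ m k → ⊤ {m ℕ.+ k} ≡ ⊤ {m} Vec.++ ⊤ {k}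
⊤-++ zero    k = refl
⊤-++ (suc m) k = ≡.cong (inside ∷_) (⊤-++ m k)

↑ˡ-∈⁺ : ∀ {m k i} {S : Subset m} {T : Subset k} → i ∈ S → i ↑ˡ k ∈ S Vec.++ T
↑ˡ-∈⁺ Vec.here        = Vec.here
↑ˡ-∈⁺ (Vec.there i∈S) = Vec.there (↑ˡ-∈⁺ i∈S)

↑ˡ-∈⁻ : ∀ {m k} i {S : Subset m} {T : Subset k} → i ↑ˡ k ∈ S Vec.++ T → i ∈ S
↑ˡ-∈⁻ zero    {_ ∷ _} Vec.here       = Vec.here
↑ˡ-∈⁻ (suc i) {_ ∷ _} (Vec.there i∈) = Vec.there (↑ˡ-∈⁻ i i∈)

↑ʳ-∈⁺ : ∀ {m k i} (S : Subset m) {T : Subset k} → i ∈ T → m ↑ʳ i ∈ S Vec.++ T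
↑ʳ-∈⁺ []      i∈T = i∈T
↑ʳ-∈⁺ (_ ∷ S) i∈T = Vec.there (↑ʳ-∈⁺ S i∈T)

↑ʳ-∈⁻ : ∀ {m k i} (S : Subset m) {T : Subset k} → m ↑ʳ i ∈ S Vec.++ T → i ∈ T
↑ʳ-∈⁻ []      i∈T            = i∈T
↑ʳ-∈⁻ (_ ∷ S) (Vec.there i∈) = ↑ʳ-∈⁻ S i∈

-- Matching on a view turns an index into an explicit injection from one of the two blocks, the form
-- required by the membership lemmas above.
data View {m k} : Fin (m ℕ.+ k) → Set where
  left  : ∀ i → View (i ↑ˡ k)
  right : ∀ j → View (m ↑ʳ j)

view : ∀ m {k} (i : Fin (m ℕ.+ k)) → View {m} i
view m i with splitAt m i in eq
... | inj₁ j = ≡.subst View (splitAt⁻¹-↑ˡ eq) (left j)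
... | inj₂ j = ≡.subst View (splitAt⁻¹-↑ʳ eq) (right j)

++-⊆⁺ : ∀ {m k} {S S′ : Subset m} {T T′ : Subset k} → S ⊆ S′ → T ⊆ T′ →
        (S Vec.++ T) ⊆ (S′ Vec.++ T′)
++-⊆⁺ {m} {S = S} {S′ = S′} S⊆ T⊆ {e} e∈ with view m e
... | left i  = ↑ˡ-∈⁺ (S⊆ (↑ˡ-∈⁻ i e∈))
... | right j = ↑ʳ-∈⁺ S′ (T⊆ (↑ʳ-∈⁻ S e∈))

++-⊆⁻ˡ : ∀ {m k} (S S′ : Subset m) {T T′ : Subset k} →
         (S Vec.++ T) ⊆ (S′ Vec.++ T′) → S ⊆ S′
++-⊆⁻ˡ S S′ ⊆ {i} i∈ = ↑ˡ-∈⁻ i (⊆ (↑ˡ-∈⁺ i∈))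

++-⊆⁻ʳ : ∀ {m k} (S S′ : Subset m) {T T′ : Subset k} →
         (S Vec.++ T) ⊆ (S′ Vec.++ T′) → T ⊆ T′
++-⊆⁻ʳ S S′ ⊆ j∈ = ↑ʳ-∈⁻ S′ (⊆ (↑ʳ-∈⁺ S j∈))

-- The independent sets of the rank one uniform matroid: `DistinctSources` for edges that all have
-- the same source.
AtMostOne : ∀ {m} → Subset m → Set
AtMostOne S = ∀ i j → i ∈ S → j ∈ S → i ≡ j

-- Send every member to the single element of a one-point set; uniqueness makes this injective.
atMostOne-size : ∀ {m} {S : Subset m} → AtMostOne S → ∣ S ∣ ℕ.≤ 1
atMostOne-size {S = S} unique = pigeonhole S ⁅ zero {0} ⁆ (λ i _ → i ∈ S)
  (λ i∈ j∈ → unique _ _ i∈ j∈) (λ i i∈S → zero , Vec.here , i∈S)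

-- The empty set if `S` is empty, and otherwise the singleton of any member.
atMostOne-maximal : ∀ {m} (S : Subset m) →
  ∃ λ I → I ⊆ S × AtMostOne I × ∣ I ∣ ≡ 1 ⊓ ∣ S ∣
atMostOne-maximal {m} S with nonempty? S
... | no  ∅ rewrite Empty-unique ∅ | ∣⊥∣≡0 m =
  ⊥ , id , (λ _ _ i∈⊥ → contradiction i∈⊥ ∉⊥) , ∣⊥∣≡0 m
... | yes (i , i∈S) =
  ⁅ i ⁆ , ⁅i⁆⊆S , (λ _ _ j∈ k∈ → ≡.trans (x∈⁅y⁆⇒x≡y i j∈) (≡.sym (x∈⁅y⁆⇒x≡y i k∈))) ,
  ≡.trans (∣⁅x⁆∣≡1 i) (≡.sym (ℕ.m≤n⇒m⊓n≡m (≡.subst (ℕ._≤ _) (∣⁅x⁆∣≡1 i) (p⊆q⇒∣p∣≤∣q∣ ⁅i⁆⊆S))))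
  where
  ⁅i⁆⊆S : ⁅ i ⁆ ⊆ S
  ⁅i⁆⊆S j∈ = ≡.subst (_∈ S) (≡.sym (x∈⁅y⁆⇒x≡y i j∈)) i∈S

-- The decomposition of 𝓜 (n + 1)

src-↑ˡ : ∀ n i → src (suc n) (i ↑ˡ #edges n) ≡ zero
src-↑ˡ n i rewrite splitAt-↑ˡ (suc n) i (#edges n) = refl

src-↑ʳ : ∀ n e → src (suc n) (suc n ↑ʳ e) ≡ suc (src n e)
src-↑ʳ n e rewrite splitAt-↑ʳ (suc n) (#edges n) e = refl

-- Edges from different blocks never share a source, one source being `zero` and the other a
-- successor. In the right block all sources are shifted by one.
distinctSources-++⁺ : ∀ n {S : Subset (suc n)} {T} → AtMostOne S → DistinctSources n T →
                      DistinctSources (suc n) (S Vec.++ T)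
distinctSources-++⁺ n {S} unique distinct e f e∈ f∈ s≡
  with view (suc n) e | view (suc n) f
... | left i  | left j  = ≡.cong (_↑ˡ _) (unique i j (↑ˡ-∈⁻ i e∈) (↑ˡ-∈⁻ j f∈))
... | left i  | right j with () ← ≡.trans (≡.sym (src-↑ˡ n i)) (≡.trans s≡ (src-↑ʳ n j))
... | right i | left j  with () ← ≡.trans (≡.sym (src-↑ʳ n i)) (≡.trans s≡ (src-↑ˡ n j))
... | right i | right j = ≡.cong (suc n ↑ʳ_) (distinct i j (↑ʳ-∈⁻ S e∈) (↑ʳ-∈⁻ S f∈)
  (suc-injective (≡.trans (≡.sym (src-↑ʳ n i)) (≡.trans s≡ (src-↑ʳ n j)))))

-- All edges of the left block have source `zero`.
distinctSources-++⁻ˡ : ∀ n {S : Subset (suc n)} {T} → DistinctSources (suc n) (S Vec.++ T) →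
                       AtMostOne S
distinctSources-++⁻ˡ n distinct i j i∈ j∈ = ↑ˡ-injective _ i j
  (distinct _ _ (↑ˡ-∈⁺ i∈) (↑ˡ-∈⁺ j∈) (≡.trans (src-↑ˡ n i) (≡.sym (src-↑ˡ n j))))

distinctSources-++⁻ʳ : ∀ n (S : Subset (suc n)) {T} → DistinctSources (suc n) (S Vec.++ T) →
                       DistinctSources n T
distinctSources-++⁻ʳ n S distinct i j i∈ j∈ s≡ = ↑ʳ-injective (suc n) i j
  (distinct _ _ (↑ʳ-∈⁺ S i∈) (↑ʳ-∈⁺ S j∈)
    (≡.trans (src-↑ʳ n i) (≡.trans (≡.cong suc s≡) (≡.sym (src-↑ʳ n j)))))

-- Rank is additive on the direct sum: largest independent sets of the blocks concatenate to an
-- independent set, and any independent set cuts into independent pieces.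
rank-++ : ∀ n (S : Subset (suc n)) (T : Subset (#edges n)) →
          rank (𝓜 (suc n)) (S Vec.++ T) ≡ 1 ⊓ ∣ S ∣ ℕ.+ rank (𝓜 n) T
rank-++ n S T with atMostOne-maximal S | rank-attained (𝓜 n) T
... | I , I⊆S , unique , I≡ | J , J⊆T , ind , J≡ =
  rank-unique (𝓜 (suc n)) (++-⊆⁺ I⊆S J⊆T)
    (distinct⇒minimal (suc n) (distinctSources-++⁺ n unique (minimal⇒distinct n ind)))
    (≡.trans (∣++∣ I J) (≡.cong₂ ℕ._+_ I≡ J≡)) bound
  where
  bound : ∀ {K} → K ⊆ (S Vec.++ T) → MinimalGenerating (suc n) K →
          ∣ K ∣ ℕ.≤ 1 ⊓ ∣ S ∣ ℕ.+ rank (𝓜 n) T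
  bound {K} K⊆ ind with Vec.splitAt (suc n) K
  ... | K₁ , K₂ , refl = ≡.subst (ℕ._≤ _) (≡.sym (∣++∣ K₁ K₂)) (ℕ.+-mono-≤
    (ℕ.⊓-glb (atMostOne-size (distinctSources-++⁻ˡ n {K₁} distinct))
             (p⊆q⇒∣p∣≤∣q∣ (++-⊆⁻ˡ K₁ S K⊆)))
    (independent-≤-rank (𝓜 n) (++-⊆⁻ʳ K₁ S K⊆)
      (distinct⇒minimal n (distinctSources-++⁻ʳ n K₁ distinct))))
    where
    distinct : DistinctSources (suc n) (K₁ Vec.++ K₂)
    distinct = minimal⇒distinct (suc n) ind

rank-⊤ : ∀ n → rank (𝓜 (suc n)) ⊤ ≡ suc (rank (𝓜 n) ⊤)
rank-⊤ n = ≡.trans (≡.cong (rank (𝓜 (suc n))) (⊤-++ (suc n) (#edges n)))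
                   -- The first block is nonempty, so `1 ⊓ ∣ ⊤ ∣` computes to 1.
                   (rank-++ n ⊤ ⊤)

-- The hypotheses exclude truncation in either part; this splits the exponents of a Tutte term
-- between the two blocks.
+-∸-+ : ∀ {a b c d} → c ℕ.≤ a → d ℕ.≤ b → (a ℕ.+ b) ∸ (c ℕ.+ d) ≡ (a ∸ c) ℕ.+ (b ∸ d)
+-∸-+ {a} {b} {c} {d} c≤a d≤b = begin
  (a ℕ.+ b) ∸ (c ℕ.+ d)  ≡⟨ ℕ.∸-+-assoc (a ℕ.+ b) c d ⟨
  a ℕ.+ b ∸ c ∸ d        ≡⟨ ≡.cong (_∸ d) (ℕ.+-∸-comm b c≤a) ⟩
  (a ∸ c) ℕ.+ b ∸ d      ≡⟨ ℕ.+-∸-assoc (a ∸ c) d≤b ⟩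
  (a ∸ c) ℕ.+ (b ∸ d)    ∎
  where open ≡.≡-Reasoning

-- The Tutte sum over an arbitrary commutative ring

module _ {c ℓ} (R : CommutativeRing c ℓ) where
  open CommutativeRing R renaming (Carrier to A; refl to ≈-refl; setoid to ≈-setoid)
  open Exp semiring using (_^_; ^-homo-*)
  open CommutativeSemigroup *-commutativeSemigroup using (interchange)
  open SubsetSums R
  open import Relation.Binary.Reasoning.Setoid ≈-setoid

  module _ (u v : A) where

    term : (M : Matroid) → Subset (Matroid.size M) → A
    term M S = u ^ (rank M ⊤ ∸ rank M S) * v ^ (∣ S ∣ ∸ rank M S)

    term-++ : ∀ n (S : Subset (suc n)) T →
              term (𝓜 (suc n)) (S Vec.++ T) ≈ uniformTerm u v S * term (𝓜 n) T
    term-++ n S T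
      -- The successor in `rank-⊤` is the total rank 1 of the first block, matching the 1 in
      -- `uniformTerm`.
      rewrite rank-++ n S T | rank-⊤ n | ∣++∣ S T
            | +-∸-+ (ℕ.m⊓n≤m 1 ∣ S ∣) (rank-mono (𝓜 n) (⊆⊤ {p = T}))
            | +-∸-+ (ℕ.m⊓n≤n 1 ∣ S ∣) (rank-≤-size (𝓜 n) T) = trans
      (*-cong (^-homo-* u (1 ∸ 1 ⊓ ∣ S ∣) _) (^-homo-* v (∣ S ∣ ∸ 1 ⊓ ∣ S ∣) _))
      (interchange _ _ _ _)

    module _ (w : A) (v+1≈w : v + 1# ≈ w) where

      -- The contribution of a source with `k` outgoing edges.
      factor : ℕ → A
      factor k = u + sum (map (w ^_) (upTo k))

      Σ⊆-term : ∀ n → Σ⊆ (#edges n) (term (𝓜 n)) ≈ product (map factor (applyUpTo suc n))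
      -- There are no edges and rank is bounded by size, so both exponents vanish and the only
      -- summand is 1.
      Σ⊆-term zero    rewrite ℕ.n≤0⇒n≡0 (rank-≤-size (𝓜 0) []) =
        trans (+-identityʳ _) (*-identityʳ 1#)
      Σ⊆-term (suc n) = begin
        Σ⊆ (suc n ℕ.+ #edges n) (term (𝓜 (suc n)))
          ≈⟨ Σ⊆-++ (suc n) (#edges n) (uniformTerm u v) (term-++ n) ⟩
        Σ⊆ (suc n) (uniformTerm u v) * Σ⊆ (#edges n) (term (𝓜 n))
          ≈⟨ *-cong (Σ⊆-uniformTerm v w v+1≈w u (suc n)) (Σ⊆-term n) ⟩
        factor (suc n) * product (map factor (applyUpTo suc n))
          -- The new source 0 has the most outgoing edges, so its factor belongs at the end of the
          -- list.
          ≈⟨ *-comm _ _ ⟩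
        product (map factor (applyUpTo suc n)) * factor (suc n)
          ≈⟨ product-map-applyUpTo-suc factor suc n ⟨
        product (map factor (applyUpTo suc (suc n))) ∎

-- Specialisation to integer polynomials in x and y

commutativeRing-ℤ[x,y] : CommutativeRing _ _
commutativeRing-ℤ[x,y] =
  Polynomials.commutativeRing-[X] (Polynomials.commutativeRing-[X] ℤ.+-*-commutativeRing)

open import Defs

y-1+1≈y : y ⊖ 1# + 1# ≈ y
-- The polynomials are given explicitly since `≈` unfolds to equality of coefficients, from which
-- they cannot be inferred.
y-1+1≈y = trans {y ⊖ 1# + 1#} {y + (- 1# + 1#)} {y} (+-assoc y (- 1#) 1#)
  (trans {y + (- 1# + 1#)} {y + 0#} {y} (+-congˡ {y} { - 1# + 1#} {0#} (-‿inverseˡ 1#))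
    (+-identityʳ y))
  where open CommutativeRing commutativeRing-ℤ[x,y]
          using (trans; +-assoc; +-congˡ; +-identityʳ; -‿inverseˡ)

theorem3p3 : ∀ (n : ℕ) →
    tutte (𝓜 n) ≈ ∏ (map (λ k → x ⊖ 1# + ⟨ k ⟩ʸ) (applyUpTo suc n))
-- The general identity at `u = x - 1`, `v = y - 1` and `w = y`; both sides then agree with the
-- claim by computation.
theorem3p3 = Σ⊆-term commutativeRing-ℤ[x,y] (x ⊖ 1#) (y ⊖ 1#) y y-1+1≈y
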